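{- The sequent calculus $\mathcal{G}\mathrm{Ciore}$ admits cut-elimination: for all finite sets of formulas $\Gamma,\Delta$, if the sequent $\Gamma\Rightarrow\Delta$ is provable in $\mathcal{G}\mathrm{Ciore}$ (possibly using the cut rule), then $\Gamma\Rightarrow\Delta$ has a proof in $\mathcal{G}\mathrm{Ciore}$ that does not use the cut rule.
   Context: Formulas are built from a denumerable set of propositional variables with binary connectives $\wedge,\vee,\to$ and unary connectives $\neg,\circ$. A sequent is an expression $\Gamma\Rightarrow\Delta$ with $\Gamma,\Delta$ finite sets of formulas; "$\Gamma,\alpha$" means $\Gamma\cup\{\alpha\}$. The calculus $\mathcal{G}\mathrm{Ciore}$ has the following axioms and rules (for all formulas $\alpha,\beta$ and finite sets $\Gamma,\Delta$; "from ... infer ..." lists the premises, then the conclusion). Axioms: $\alpha\Rightarrow\alpha$. Structural rules: (w$\Rightarrow$) from $\Gamma\Rightarrow\Delta$ infer $\Gamma,\alpha\Rightarrow\Delta$; ($\Rightarrow$w) from $\Gamma\Rightarrow\Delta$ infer $\Gamma\Rightarrow\Delta,\alpha$; (cut) from $\Gamma\Rightarrow\Delta,\alpha$ and $\Gamma,\alpha\Rightarrow\Delta$ infer $\Gamma\Rightarrow\Delta$. Logical rules: ($\vee\Rightarrow$) from $\Gamma,\alpha\Rightarrow\Delta$ and $\Gamma,\beta\Rightarrow\Delta$ infer $\Gamma,\alpha\vee\beta\Rightarrow\Delta$. ($\Rightarrow\vee$) from $\Gamma\Rightarrow\Delta,\alpha,\beta$ infer $\Gamma\Rightarrow\Delta,\alpha\vee\beta$.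 ($\neg\vee\Rightarrow$) from $\Gamma,\alpha,\neg\alpha,\beta,\neg\beta\Rightarrow\Delta$ and $\Gamma,\neg\alpha,\neg\beta\Rightarrow\Delta,\alpha,\beta$ infer $\Gamma,\neg(\alpha\vee\beta)\Rightarrow\Delta$. ($\Rightarrow\neg\vee$) from $\Gamma\Rightarrow\Delta,\alpha$; $\Gamma\Rightarrow\Delta,\neg\alpha$; $\Gamma\Rightarrow\Delta,\beta$; $\Gamma\Rightarrow\Delta,\neg\beta$ infer $\Gamma\Rightarrow\Delta,\neg(\alpha\vee\beta)$. ($\wedge\Rightarrow$) from $\Gamma,\alpha,\beta\Rightarrow\Delta$ infer $\Gamma,\alpha\wedge\beta\Rightarrow\Delta$. ($\Rightarrow\wedge$) from $\Gamma\Rightarrow\Delta,\alpha$ and $\Gamma\Rightarrow\Delta,\beta$ infer $\Gamma\Rightarrow\Delta,\alpha\wedge\beta$. ($\neg\wedge\Rightarrow$) from $\Gamma\Rightarrow\Delta,\alpha,\beta$; $\Gamma,\neg\alpha\Rightarrow\Delta,\alpha$; $\Gamma,\neg\beta\Rightarrow\Delta,\beta$; $\Gamma,\neg\alpha,\neg\beta\Rightarrow\Delta$ infer $\Gamma,\neg(\alpha\wedge\beta)\Rightarrow\Delta$. ($\Rightarrow\neg\wedge$) from $\Gamma\Rightarrow\Delta,\alpha$; $\Gamma\Rightarrow\Delta,\neg\alpha$; $\Gamma\Rightarrow\Delta,\beta$; $\Gamma\Rightarrow\Delta,\neg\beta$ infer $\Gamma\Rightarrow\Delta,\neg(\alpha\wedge\beta)$.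 ($\to\Rightarrow$) from $\Gamma\Rightarrow\Delta,\alpha$ and $\Gamma,\beta\Rightarrow\Delta$ infer $\Gamma,\alpha\to\beta\Rightarrow\Delta$. ($\Rightarrow\to$) from $\Gamma,\alpha\Rightarrow\Delta,\beta$ infer $\Gamma\Rightarrow\Delta,\alpha\to\beta$. ($\neg\to\Rightarrow$) from $\Gamma,\alpha,\neg\beta\Rightarrow\Delta,\beta$ and $\Gamma,\alpha,\neg\alpha,\neg\beta\Rightarrow\Delta$ infer $\Gamma,\neg(\alpha\to\beta)\Rightarrow\Delta$. ($\Rightarrow\neg\to$) from $\Gamma\Rightarrow\Delta,\alpha$; $\Gamma\Rightarrow\Delta,\neg\alpha$; $\Gamma\Rightarrow\Delta,\beta$; $\Gamma\Rightarrow\Delta,\neg\beta$ infer $\Gamma\Rightarrow\Delta,\neg(\alpha\to\beta)$. ($\Rightarrow\neg$) from $\Gamma,\alpha\Rightarrow\Delta$ infer $\Gamma\Rightarrow\Delta,\neg\alpha$. ($\neg\neg\Rightarrow$) from $\Gamma,\alpha\Rightarrow\Delta$ infer $\Gamma,\neg\neg\alpha\Rightarrow\Delta$. ($\Rightarrow\neg\neg$) from $\Gamma\Rightarrow\Delta,\alpha$ infer $\Gamma\Rightarrow\Delta,\neg\neg\alpha$. ($\circ\Rightarrow$) from $\Gamma\Rightarrow\Delta,\alpha$ and $\Gamma\Rightarrow\Delta,\neg\alpha$ infer $\Gamma,\circ\alpha\Rightarrow\Delta$. ($\Rightarrow\circ$) from $\Gamma,\alpha,\neg\alpha\Rightarrow\Delta$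 infer $\Gamma\Rightarrow\Delta,\circ\alpha$. ($\neg\circ\Rightarrow$) from $\Gamma,\alpha,\neg\alpha\Rightarrow\Delta$ infer $\Gamma,\neg\circ\alpha\Rightarrow\Delta$. -}

module Defs where

open import Data.Empty using (⊥)
open import Data.List.Base using (List; []; _∷_)
open import Data.List.Relation.Binary.BagAndSetEquality using (_∼[_]_; set)
open import Data.List.Relation.Unary.All using (All; []; _∷_)
open import Data.Nat.Base using (ℕ)
open import Data.Product.Base using (_×_)
open import Data.Unit.Base using (⊤)
import Relation.Nullary.Negation.Core as Meta

infix  11 ¬_ ∘_
infixr 10 _∧_
infixr 9  _∨_
infixr 8  _⟶_
infixl 7  _▸_
infix  6  _⇒_
infix  4  _≈_

data Formula : Set where
  var : ℕ → Formula
  _∧_ _∨_ _⟶_ : Formula → Formula → Formula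
  ¬_ ∘_ : Formula → Formula

-- A finite set of formulas is represented by a list enumerating its elements,
-- possibly with repetitions.  Two lists denote the same set when they have the
-- same members, so sequents are identified up to _≈_ below.
FinSet : Set
FinSet = List Formula

-- Γ ▸ α denotes Γ ∪ {α}; α may already belong to Γ.
_▸_ : FinSet → Formula → FinSet
Γ ▸ α = α ∷ Γ

record Sequent : Set where
  constructor _⇒_
  field
    antecedent succedent : FinSet

_≈_ : Sequent → Sequent → Set
(Γ ⇒ Δ) ≈ (Γ′ ⇒ Δ′) = (Γ ∼[ set ] Γ′) × (Δ ∼[ set ] Δ′)

private variable
  Γ Δ : FinSet
  α β : Formula
  S T : Sequent
  Ps  : List Sequent

-- Rule Ps S: the sequent S follows from the premises Ps by one rule instance.
data Rule : List Sequent → Sequent → Set where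
  ax   : Rule [] ([] ▸ α ⇒ [] ▸ α)

  w⇒   : Rule ((Γ ⇒ Δ) ∷ []) (Γ ▸ α ⇒ Δ)
  ⇒w   : Rule ((Γ ⇒ Δ) ∷ []) (Γ ⇒ Δ ▸ α)
  cut  : Rule ((Γ ⇒ Δ ▸ α) ∷ (Γ ▸ α ⇒ Δ) ∷ []) (Γ ⇒ Δ)

  ∨⇒   : Rule ((Γ ▸ α ⇒ Δ) ∷ (Γ ▸ β ⇒ Δ) ∷ []) (Γ ▸ (α ∨ β) ⇒ Δ)
  ⇒∨   : Rule ((Γ ⇒ Δ ▸ α ▸ β) ∷ []) (Γ ⇒ Δ ▸ (α ∨ β))
  ¬∨⇒  : Rule ((Γ ▸ α ▸ ¬ α ▸ β ▸ ¬ β ⇒ Δ) ∷ (Γ ▸ ¬ α ▸ ¬ β ⇒ Δ ▸ α ▸ β) ∷ [])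
              (Γ ▸ ¬ (α ∨ β) ⇒ Δ)
  ⇒¬∨  : Rule ((Γ ⇒ Δ ▸ α) ∷ (Γ ⇒ Δ ▸ ¬ α) ∷ (Γ ⇒ Δ ▸ β) ∷ (Γ ⇒ Δ ▸ ¬ β) ∷ [])
              (Γ ⇒ Δ ▸ ¬ (α ∨ β))

  ∧⇒   : Rule ((Γ ▸ α ▸ β ⇒ Δ) ∷ []) (Γ ▸ (α ∧ β) ⇒ Δ)
  ⇒∧   : Rule ((Γ ⇒ Δ ▸ α) ∷ (Γ ⇒ Δ ▸ β) ∷ []) (Γ ⇒ Δ ▸ (α ∧ β))
  ¬∧⇒  : Rule ((Γ ⇒ Δ ▸ α ▸ β) ∷ (Γ ▸ ¬ α ⇒ Δ ▸ α) ∷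
               (Γ ▸ ¬ β ⇒ Δ ▸ β) ∷ (Γ ▸ ¬ α ▸ ¬ β ⇒ Δ) ∷ [])
              (Γ ▸ ¬ (α ∧ β) ⇒ Δ)
  ⇒¬∧  : Rule ((Γ ⇒ Δ ▸ α) ∷ (Γ ⇒ Δ ▸ ¬ α) ∷ (Γ ⇒ Δ ▸ β) ∷ (Γ ⇒ Δ ▸ ¬ β) ∷ [])
              (Γ ⇒ Δ ▸ ¬ (α ∧ β))

  ⟶⇒   : Rule ((Γ ⇒ Δ ▸ α) ∷ (Γ ▸ β ⇒ Δ) ∷ []) (Γ ▸ (α ⟶ β) ⇒ Δ)
  ⇒⟶   : Rule ((Γ ▸ α ⇒ Δ ▸ β) ∷ []) (Γ ⇒ Δ ▸ (α ⟶ β))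
  ¬⟶⇒  : Rule ((Γ ▸ α ▸ ¬ β ⇒ Δ ▸ β) ∷ (Γ ▸ α ▸ ¬ α ▸ ¬ β ⇒ Δ) ∷ [])
              (Γ ▸ ¬ (α ⟶ β) ⇒ Δ)
  ⇒¬⟶  : Rule ((Γ ⇒ Δ ▸ α) ∷ (Γ ⇒ Δ ▸ ¬ α) ∷ (Γ ⇒ Δ ▸ β) ∷ (Γ ⇒ Δ ▸ ¬ β) ∷ [])
              (Γ ⇒ Δ ▸ ¬ (α ⟶ β))

  ⇒¬   : Rule ((Γ ▸ α ⇒ Δ) ∷ []) (Γ ⇒ Δ ▸ ¬ α)
  ¬¬⇒  : Rule ((Γ ▸ α ⇒ Δ) ∷ []) (Γ ▸ ¬ ¬ α ⇒ Δ)
  ⇒¬¬  : Rule ((Γ ⇒ Δ ▸ α) ∷ []) (Γ ⇒ Δ ▸ ¬ ¬ α)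

  ∘⇒   : Rule ((Γ ⇒ Δ ▸ α) ∷ (Γ ⇒ Δ ▸ ¬ α) ∷ []) (Γ ▸ ∘ α ⇒ Δ)
  ⇒∘   : Rule ((Γ ▸ α ▸ ¬ α ⇒ Δ) ∷ []) (Γ ⇒ Δ ▸ ∘ α)
  ¬∘⇒  : Rule ((Γ ▸ α ▸ ¬ α ⇒ Δ) ∷ []) (Γ ▸ ¬ ∘ α ⇒ Δ)

-- Every node of a proof is an instance of a rule.  Since sequents consist of
-- sets, the conclusion of a node may be written with any enumeration of its
-- two sides; this is the only role of the _≈_ argument.
data Proof : Sequent → Set where
  infer : Rule Ps S → S ≈ T → All Proof Ps → Proof T

IsCut : Rule Ps S → Set
IsCut cut = ⊤
IsCut _   = ⊥

CutFree    : Proof S → Set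
CutFreeAll : All Proof Ps → Set

CutFree (infer r _ ds) = Meta.¬ (IsCut r) × CutFreeAll ds

CutFreeAll []       = ⊤
CutFreeAll (d ∷ ds) = CutFree d × CutFreeAll ds

{-# OPTIONS --safe #-}
-- Read ∧, ∨, ⟶ over the values 𝟎, ½, 𝟏, with ½ and 𝟏 designated, so that
-- a compound has value ½ exactly when both components do.  All rules, cut
-- included, preserve validity.  Conversely every sequent either has a cut-free
-- proof or a countermodel: the rules read upwards reduce it to literals without
-- creating countermodels.  The only logical rules that can create one are ⇒¬ and
-- ⇒¬∧, ⇒¬∨, ⇒¬⟶; on negated binary compounds use their invertible combination
--   from Γ, α # β ⇒ Δ, χ  for χ = α, ¬ α, β, ¬ β,  infer  Γ ⇒ Δ, ¬ (α # β).
module Submission where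

open import Data.Bool.Base as Bool using (Bool; true; false; T)
open import Data.Bool.Properties as Boolₚ using (T?)
open import Data.Empty using (⊥-elim)
open import Data.List.Base using (List; []; _∷_; _++_; map)
open import Data.List.Properties using (++-assoc; ++-identityʳ)
open import Data.List.Membership.Propositional using (_∈_; find; lose)
open import Data.List.Membership.Propositional.Properties using (∈-++⁻; ∈-++⁺ˡ; ∈-map⁺)
import Data.List.Membership.DecPropositional as DecMembership
open import Data.List.Relation.Binary.BagAndSetEquality
  using (set; [_]-Equality; bag-=⇒; ↭⇒∼bag)
open import Data.List.Relation.Binary.Permutation.Propositional.Properties using (shift)
open import Data.List.Relation.Binary.Subset.Propositional using (_⊆_)
open import Data.List.Relation.Binary.Subset.Propositional.Properties using (⊆-refl)
open import Data.List.Relation.Unary.All as All using (All; []; _∷_)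
import Data.List.Relation.Unary.All.Properties as All
open import Data.List.Relation.Unary.Any as Any using (Any; here; there)
import Data.List.Relation.Unary.Any.Properties as Any
open import Data.Nat.Base using (ℕ; zero; suc)
import Data.Nat.Properties as ℕ
open import Data.Product using (Σ-syntax; ∃; _×_; _,_; proj₁; proj₂)
import Data.Product.Properties as Product
open import Data.Sum.Base using (_⊎_; inj₁; inj₂; [_,_]′)
open import Data.Unit.Base using (tt)
open import Function.Base using (id)
open import Function.Bundles using (Equivalence; mk⇔)
open import Relation.Binary.Bundles using (Setoid)
open import Relation.Binary.PropositionalEquality
  using (_≡_; refl; sym; cong; cong₂; subst)
open import Relation.Nullary.Decidable
  using (Dec; yes; no; True; toWitness; map′; _×-dec_; _→-dec_)
import Relation.Nullary.Negation.Core as Meta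
open import Relation.Unary using (Decidable)
open import Defs

module SetEq = Setoid ([ set ]-Equality Formula)

private variable
  Γ Γ′ Δ Δ′ : FinSet
  α β : Formula
  S U : Sequent
  Ps : List Sequent

-- Semantics

data Value : Set where
  𝟎 ½ 𝟏 : Value

designated : Value → Bool
designated 𝟎 = false
designated ½ = true
designated 𝟏 = true

boolean : Bool → Value
boolean false = 𝟎
boolean true  = 𝟏

binary : (Bool → Bool → Bool) → Value → Value → Value
binary f ½ ½ = ½
binary f x y = boolean (f (designated x) (designated y))

negation : Value → Value
negation 𝟎 = 𝟏
negation ½ = ½
negation 𝟏 = 𝟎

consistency : Value → Value
consistency 𝟎 = 𝟏
consistency ½ = 𝟎
consistency 𝟏 = 𝟏

Valuation : Set
Valuation = ℕ → Value

eval : Valuation → Formula → Value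
eval v (var n) = v n
eval v (α ∧ β) = binary Bool._∧_ (eval v α) (eval v β)
eval v (α ∨ β) = binary Bool._∨_ (eval v α) (eval v β)
eval v (α ⟶ β) = binary (λ a b → Bool.not a Bool.∨ b) (eval v α) (eval v β)
eval v (¬ α)   = negation (eval v α)
eval v (∘ α)   = consistency (eval v α)

Holds Fails : Valuation → Formula → Set
Holds v α = T (designated (eval v α))
Fails v α = T (Bool.not (designated (eval v α)))

Refutes : Valuation → Sequent → Set
Refutes v (Γ ⇒ Δ) = All (Holds v) Γ × All (Fails v) Δ

refutes? : ∀ v → Decidable (Refutes v)
refutes? v (Γ ⇒ Δ) = All.all? (λ α → T? _) Γ ×-dec All.all? (λ α → T? _) Δ

refutes-antimono : ∀ {v} → Γ ⊆ Γ′ → Δ ⊆ Δ′ → Refutes v (Γ′ ⇒ Δ′) → Refutes v (Γ ⇒ Δ)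
refutes-antimono Γ⊆ Δ⊆ (γ , δ) = All.anti-mono Γ⊆ γ , All.anti-mono Δ⊆ δ

-- Rule schemas

-- Side formulas go on the right: a list extended by `_▸_` grows at the front, so appending them to
-- a closed schema computes to the shape found in `Rule`.
_⊕_ : Sequent → Sequent → Sequent
(Γ ⇒ Δ) ⊕ (Γ′ ⇒ Δ′) = (Γ ++ Γ′) ⇒ (Δ ++ Δ′)

⊕-assoc : ∀ S U P → (S ⊕ U) ⊕ P ≡ S ⊕ (U ⊕ P)
⊕-assoc (Γ ⇒ Δ) (Γ′ ⇒ Δ′) (Γ″ ⇒ Δ″) = cong₂ _⇒_ (++-assoc Γ Γ′ Γ″) (++-assoc Δ Δ′ Δ″)

⊕-identityʳ : ∀ S → S ⊕ ([] ⇒ []) ≡ S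
⊕-identityʳ (Γ ⇒ Δ) = cong₂ _⇒_ (++-identityʳ Γ) (++-identityʳ Δ)

-- Serves both as the substitution of two formulas for `p`, `q` and as the valuation giving them two
-- values.
pair : ∀ {A : Set} → A → A → ℕ → A
pair a b zero    = a
pair a b (suc _) = b

substitute : (ℕ → Formula) → Formula → Formula
substitute σ (var n) = σ n
substitute σ (α ∧ β) = substitute σ α ∧ substitute σ β
substitute σ (α ∨ β) = substitute σ α ∨ substitute σ β
substitute σ (α ⟶ β) = substitute σ α ⟶ substitute σ β
substitute σ (¬ α)   = ¬ substitute σ α
substitute σ (∘ α)   = ∘ substitute σ α

eval-substitute : ∀ {v w σ} → (∀ n → eval v (σ n) ≡ w n) →
                  ∀ α → eval v (substitute σ α) ≡ eval w α
eval-substitute e (var n) = e n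
eval-substitute e (α ∧ β) = cong₂ (binary _) (eval-substitute e α) (eval-substitute e β)
eval-substitute e (α ∨ β) = cong₂ (binary _) (eval-substitute e α) (eval-substitute e β)
eval-substitute e (α ⟶ β) = cong₂ (binary _) (eval-substitute e α) (eval-substitute e β)
eval-substitute e (¬ α)   = cong negation (eval-substitute e α)
eval-substitute e (∘ α)   = cong consistency (eval-substitute e α)

p q : Formula
p = var 0
q = var 1

substituteˢ : (ℕ → Formula) → Sequent → Sequent
substituteˢ σ (Γ ⇒ Δ) = map (substitute σ) Γ ⇒ map (substitute σ) Δ

-- A rule schema is stated with p, q for α, β and with empty side formulas;
-- U supplies the latter.
instantiate : Formula → Formula → Sequent → Sequent → Sequent
instantiate α β U S = substituteˢ (pair α β) S ⊕ U

module _ (v : Valuation) (α β : Formula) where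

  -- An instance of a schema depends on `v` only through the values of `α` and `β`, so nine
  -- valuations of `p`, `q` represent all cases.
  schematic : Valuation
  schematic = pair (eval v α) (eval v β)

  private
    agree : ∀ χ → eval v (substitute (pair α β) χ) ≡ eval schematic χ
    agree = eval-substitute λ { zero → refl ; (suc _) → refl }

    module _ {F : Value → Set} where
      to : ∀ {χs} → All (λ χ → F (eval v χ)) (map (substitute (pair α β)) χs) →
           All (λ χ → F (eval schematic χ)) χs
      to ps = All.map (λ {χ} → subst F (agree χ)) (All.map⁻ ps)

      from : ∀ {χs} → All (λ χ → F (eval schematic χ)) χs →
             All (λ χ → F (eval v χ)) (map (substitute (pair α β)) χs)
      from ps = All.map⁺ (All.map (λ {χ} → subst F (sym (agree χ))) ps)

  refutes-instance⁻ : ∀ S → Refutes v (instantiate α β U S) → Refutes schematic S × Refutes v U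
  refutes-instance⁻ (Γ ⇒ Δ) (γ , δ) with All.++⁻ _ γ | All.++⁻ _ δ
  ... | γ₁ , γ₂ | δ₁ , δ₂ =
    (to {λ x → T (designated x)} γ₁ , to {λ x → T (Bool.not (designated x))} δ₁) , γ₂ , δ₂

  refutes-instance⁺ : ∀ S → Refutes schematic S → Refutes v U → Refutes v (instantiate α β U S)
  refutes-instance⁺ (Γ ⇒ Δ) (γ₁ , δ₁) (γ₂ , δ₂) =
    All.++⁺ (from {λ x → T (designated x)} γ₁) γ₂ ,
    All.++⁺ (from {λ x → T (Bool.not (designated x))} δ₁) δ₂

allValues? : {F : Value → Set} → Decidable F → Dec (∀ x → F x)
allValues? F? = map′ (λ { (a , b , c) → λ { 𝟎 → a ; ½ → b ; 𝟏 → c } })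
                     (λ f → f 𝟎 , f ½ , f 𝟏)
                     (F? 𝟎 ×-dec F? ½ ×-dec F? 𝟏)

-- Both are phrased by countermodels: soundness carries one from the conclusion up to some premise,
-- invertibility from a premise down to the conclusion.
Sound Invertible : List Sequent → Sequent → Set
Sound Ps S = ∀ x y → Refutes (pair x y) S → Any (Refutes (pair x y)) Ps
Invertible Ps S = ∀ x y → Any (Refutes (pair x y)) Ps → Refutes (pair x y) S

sound? : ∀ Ps S → Dec (Sound Ps S)
sound? Ps S = allValues? λ x → allValues? λ y →
  refutes? (pair x y) S →-dec Any.any? (refutes? (pair x y)) Ps

invertible? : ∀ Ps S → Dec (Invertible Ps S)
invertible? Ps S = allValues? λ x → allValues? λ y →
  Any.any? (refutes? (pair x y)) Ps →-dec refutes? (pair x y) S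

-- Soundness

-- For a closed schema the implicit argument is found by evaluating `sound?` on all nine pairs of
-- values.
by-table : Rule Ps S → {True (sound? Ps S)} → ∀ α β U {v} →
           Refutes v (instantiate α β U S) → Any (Refutes v) (map (instantiate α β U) Ps)
by-table {Ps} {S} _ {t} α β U {v} r with refutes-instance⁻ v α β S r
... | s , u = Any.map⁺ (Any.map (λ {P} s′ → refutes-instance⁺ v α β P s′ u)
                                (toWitness {a? = sound? Ps S} t _ _ s))

-- Each rule instance is definitionally an `instantiate` of its schema; schemas in `p` alone receive
-- `α` twice.
rule-sound : ∀ {v} → Rule Ps S → Refutes v S → Any (Refutes v) Ps
rule-sound (ax {α})              = by-table (ax {p}) α α ([] ⇒ [])
rule-sound (w⇒ {Γ} {Δ} {α})      = by-table (w⇒ {[]} {[]} {p}) α α (Γ ⇒ Δ)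
rule-sound (⇒w {Γ} {Δ} {α})      = by-table (⇒w {[]} {[]} {p}) α α (Γ ⇒ Δ)
rule-sound (cut {Γ} {Δ} {α})     = by-table (cut {[]} {[]} {p}) α α (Γ ⇒ Δ)
rule-sound (∨⇒ {Γ} {α} {Δ} {β})  = by-table (∨⇒ {[]} {p} {[]} {q}) α β (Γ ⇒ Δ)
rule-sound (⇒∨ {Γ} {Δ} {α} {β})  = by-table (⇒∨ {[]} {[]} {p} {q}) α β (Γ ⇒ Δ)
rule-sound (¬∨⇒ {Γ} {α} {β} {Δ}) = by-table (¬∨⇒ {[]} {p} {q} {[]}) α β (Γ ⇒ Δ)
rule-sound (⇒¬∨ {Γ} {Δ} {α} {β}) = by-table (⇒¬∨ {[]} {[]} {p} {q}) α β (Γ ⇒ Δ)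
rule-sound (∧⇒ {Γ} {α} {β} {Δ})  = by-table (∧⇒ {[]} {p} {q} {[]}) α β (Γ ⇒ Δ)
rule-sound (⇒∧ {Γ} {Δ} {α} {β})  = by-table (⇒∧ {[]} {[]} {p} {q}) α β (Γ ⇒ Δ)
rule-sound (¬∧⇒ {Γ} {Δ} {α} {β}) = by-table (¬∧⇒ {[]} {[]} {p} {q}) α β (Γ ⇒ Δ)
rule-sound (⇒¬∧ {Γ} {Δ} {α} {β}) = by-table (⇒¬∧ {[]} {[]} {p} {q}) α β (Γ ⇒ Δ)
rule-sound (⟶⇒ {Γ} {Δ} {α} {β})  = by-table (⟶⇒ {[]} {[]} {p} {q}) α β (Γ ⇒ Δ)
rule-sound (⇒⟶ {Γ} {α} {Δ} {β})  = by-table (⇒⟶ {[]} {p} {[]} {q}) α β (Γ ⇒ Δ)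
rule-sound (¬⟶⇒ {Γ} {α} {β} {Δ}) = by-table (¬⟶⇒ {[]} {p} {q} {[]}) α β (Γ ⇒ Δ)
rule-sound (⇒¬⟶ {Γ} {Δ} {α} {β}) = by-table (⇒¬⟶ {[]} {[]} {p} {q}) α β (Γ ⇒ Δ)
rule-sound (⇒¬ {Γ} {α} {Δ})      = by-table (⇒¬ {[]} {p} {[]}) α α (Γ ⇒ Δ)
rule-sound (¬¬⇒ {Γ} {α} {Δ})     = by-table (¬¬⇒ {[]} {p} {[]}) α α (Γ ⇒ Δ)
rule-sound (⇒¬¬ {Γ} {Δ} {α})     = by-table (⇒¬¬ {[]} {[]} {p}) α α (Γ ⇒ Δ)
rule-sound (∘⇒ {Γ} {Δ} {α})      = by-table (∘⇒ {[]} {[]} {p}) α α (Γ ⇒ Δ)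
rule-sound (⇒∘ {Γ} {α} {Δ})      = by-table (⇒∘ {[]} {p} {[]}) α α (Γ ⇒ Δ)
rule-sound (¬∘⇒ {Γ} {α} {Δ})     = by-table (¬∘⇒ {[]} {p} {[]}) α α (Γ ⇒ Δ)

-- A countermodel would climb from premise to premise up to an axiom, which has no premise to
-- receive it.
irrefutable    : ∀ {v} → Proof S → Meta.¬ Refutes v S
irrefutableAll : ∀ {v} → All Proof Ps → Meta.¬ Any (Refutes v) Ps

irrefutable (infer r (Γ≈ , Δ≈) ds) c =
  irrefutableAll ds (rule-sound r (refutes-antimono (Equivalence.to Γ≈) (Equivalence.to Δ≈) c))

irrefutableAll (d ∷ ds) (here c)  = irrefutable d c
irrefutableAll (d ∷ ds) (there c) = irrefutableAll ds c

-- Cut-free provability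

Provable : Sequent → Set
Provable S = Σ[ d ∈ Proof S ] CutFree d

derive : (r : Rule Ps S) → Meta.¬ IsCut r → All Provable Ps → Provable S
derive r nc ds = infer r (SetEq.refl , SetEq.refl) (proj₁ (unzip ds)) , nc , proj₂ (unzip ds)
  where
  unzip : All Provable Ps → Σ[ ds ∈ All Proof Ps ] CutFreeAll ds
  unzip []             = [] , tt
  unzip ((d , c) ∷ ds) = d ∷ proj₁ (unzip ds) , c , proj₂ (unzip ds)

provable-resp-≈ : S ≈ U → Provable S → Provable U
provable-resp-≈ (Γ≈ , Δ≈) (infer r (Γ≈′ , Δ≈′) ds , c) =
  infer r (SetEq.trans Γ≈′ Γ≈ , SetEq.trans Δ≈′ Δ≈) ds , c

provable-⊕ : ∀ U → Provable S → Provable (U ⊕ S)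
provable-⊕ ([] ⇒ [])      d = d
provable-⊕ ([] ⇒ (α ∷ Δ)) d = derive ⇒w (λ ()) (provable-⊕ ([] ⇒ Δ) d ∷ [])
provable-⊕ ((α ∷ Γ) ⇒ Δ) d = derive w⇒ (λ ()) (provable-⊕ (Γ ⇒ Δ) d ∷ [])

-- Weaken by all of `Γ′` and `Δ′`; the original formulas are then repetitions, which vanish up to
-- `_≈_`.
provable-mono : Γ ⊆ Γ′ → Δ ⊆ Δ′ → Provable (Γ ⇒ Δ) → Provable (Γ′ ⇒ Δ′)
provable-mono Γ⊆ Δ⊆ d =
  provable-resp-≈ (absorb Γ⊆ , absorb Δ⊆) (provable-⊕ (_ ⇒ _) d)
  where
  absorb : Γ ⊆ Γ′ → (Γ′ ++ Γ) SetEq.≈ Γ′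
  absorb {Γ′ = Γ′} Γ⊆ = mk⇔ (λ i → [ id , Γ⊆ ]′ (∈-++⁻ Γ′ i)) ∈-++⁺ˡ

provable-common : α ∈ Γ → α ∈ Δ → Provable (Γ ⇒ Δ)
provable-common i j = provable-mono (λ { (here refl) → i }) (λ { (here refl) → j })
  (derive ax (λ ()) [])

provable-excluded-middle : α ∈ Δ → (¬ α) ∈ Δ → Provable (Γ ⇒ Δ)
provable-excluded-middle i j =
  provable-mono (λ ()) (λ { (here refl) → j ; (there (here refl)) → i })
    (derive ⇒¬ (λ ()) (derive ax (λ ()) [] ∷ []))

-- Sequents of literals

Literal : Set
Literal = Bool × ℕ

formula : Literal → Formula
formula (true  , n) = var n
formula (false , n) = ¬ var n

opposite : Literal → Literal
opposite (b , n) = Bool.not b , n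

open DecMembership (Product.≡-dec Boolₚ._≟_ ℕ._≟_) using (_∈?_)

Decided : Sequent → Set
Decided S = Provable S ⊎ ∃ λ v → Refutes v S

literals : List Literal → List Literal → Sequent
literals L R = map formula L ⇒ map formula R

module _ (L R : List Literal) where

  -- The default ½ makes both literals of a variable hold, so a literal fails only when `R` asks for
  -- it. If `R` contained both literals of `n`, the value 𝟎 would fail only the positive one;
  -- `clash-free` excludes this.
  countermodel : Valuation
  countermodel n with (true , n) ∈? R | (false , n) ∈? R
  ... | yes _ | _     = 𝟎
  ... | no _  | yes _ = 𝟏
  ... | no _  | no _  = ½

  module _ (clash-free : ∀ ℓ → ℓ ∈ R → Meta.¬ (opposite ℓ ∈ R)) where

    fails : ∀ ℓ → ℓ ∈ R → Fails countermodel (formula ℓ)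
    fails (true , n) i with (true , n) ∈? R
    ... | yes _ = tt
    ... | no ∉R = Meta.contradiction i ∉R
    fails (false , n) i with (true , n) ∈? R | (false , n) ∈? R
    ... | yes j | _     = ⊥-elim (clash-free _ j i)
    ... | no _  | yes _ = tt
    ... | no _  | no ∉R = Meta.contradiction i ∉R

  holds : ∀ ℓ → Meta.¬ (ℓ ∈ R) → Holds countermodel (formula ℓ)
  holds (true , n) ∉R with (true , n) ∈? R | (false , n) ∈? R
  ... | yes i | _     = Meta.contradiction i ∉R
  ... | no _  | yes _ = tt
  ... | no _  | no _  = tt
  holds (false , n) ∉R with (true , n) ∈? R | (false , n) ∈? R
  ... | yes _ | _     = tt
  ... | no _  | yes i = Meta.contradiction i ∉R
  ... | no _  | no _  = tt

-- Only a literal common to both sides or a complementary pair on the right closes the sequent; a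
-- complementary pair on the left is satisfied by ½.
decide-literals : ∀ L R → Decided (literals L R)
decide-literals L R with Any.any? (_∈? R) L | Any.any? (λ ℓ → opposite ℓ ∈? R) R
... | yes a | _ with find a
...   | ℓ , i , j = inj₁ (provable-common (∈-map⁺ formula i) (∈-map⁺ formula j))
decide-literals L R | no _ | yes a with find a
...   | (true  , n) , i , j = inj₁ (provable-excluded-middle (∈-map⁺ formula i) (∈-map⁺ formula j))
...   | (false , n) , i , j = inj₁ (provable-excluded-middle (∈-map⁺ formula j) (∈-map⁺ formula i))
decide-literals L R | no disjoint | no clash-free = inj₂
  ( countermodel L R
  , All.map⁺ (All.tabulate λ {ℓ} i → holds L R ℓ λ j → disjoint (lose i j))
  , All.map⁺ (All.tabulate λ {ℓ} → fails L R (λ ℓ i j → clash-free (lose i j)) ℓ))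

-- Completeness

decided-resp-≈ : S ≈ U → Decided S → Decided U
decided-resp-≈ S≈U (inj₁ d) = inj₁ (provable-resp-≈ S≈U d)
decided-resp-≈ (Γ≈ , Δ≈) (inj₂ (v , c)) =
  inj₂ (v , refutes-antimono (Equivalence.from Γ≈) (Equivalence.from Δ≈) c)

decided-all : All Decided Ps → All Provable Ps ⊎ ∃ λ v → Any (Refutes v) Ps
decided-all []                  = inj₁ []
decided-all (inj₂ (v , c) ∷ _)  = inj₂ (v , here c)
decided-all (inj₁ d ∷ ds) with decided-all ds
... | inj₁ ds′     = inj₁ (d ∷ ds′)
... | inj₂ (v , c) = inj₂ (v , there c)

-- Quantifying over all extensions by literals makes the property closed under
-- adding a formula to either side, which allows structural recursion on formulas.
Reducible : Sequent → Set
Reducible S = ∀ L R → Decided (S ⊕ literals L R)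

-- Either all premises are provable and `rule` applies, or one has a countermodel, which
-- invertibility passes down. Taking `rule` as a function rather than a `Rule` admits derived rules.
reduce : ∀ Ps S {_ : True (invertible? Ps S)} α β {U} →
         (∀ V → All Provable (map (instantiate α β V) Ps) → Provable (instantiate α β V S)) →
         All Reducible (map (instantiate α β U) Ps) → Reducible (instantiate α β U S)
reduce Ps S {t} α β {U} rule ps L R =
  subst Decided (sym (⊕-assoc (substituteˢ _ S) U (literals L R))) (conclude (decided-all premises))
  where
  V = U ⊕ literals L R

  premises : All Decided (map (instantiate α β V) Ps)
  premises = All.map⁺ (All.map (λ {P} r → subst Decided (⊕-assoc (substituteˢ _ P) U _) (r L R)) (All.map⁻ ps))

  conclude : All Provable (map (instantiate α β V) Ps) ⊎
             (∃ λ v → Any (Refutes v) (map (instantiate α β V) Ps)) →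
             Decided (instantiate α β V S)
  conclude (inj₁ ds) = inj₁ (rule V ds)
  conclude (inj₂ (v , c)) = inj₂ (v ,
    refutes-instance⁺ v α β S
      (toWitness {a? = invertible? Ps S} t _ _ (Any.map (λ {P} r → proj₁ (split P r)) c′))
      (let P , r = Any.satisfied c′ in proj₂ (split P r)))
    where
    c′ = Any.map⁻ c
    split : ∀ P → Refutes v (instantiate α β V P) → Refutes (schematic v α β) P × Refutes v V
    split = refutes-instance⁻ v α β

reduce-by : Rule Ps S → {True (invertible? Ps S)} → ∀ α β {U} →
            (∀ V → All Provable (map (instantiate α β V) Ps) → Provable (instantiate α β V S)) →
            All Reducible (map (instantiate α β U) Ps) → Reducible (instantiate α β U S)
reduce-by {Ps} {S} _ {t} = reduce Ps S {t}

-- Invertible right rules for negated binary compounds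

¬-from-assumption : ∀ {χ} → Provable (Γ ▸ χ ⇒ Δ ▸ α) → Provable (Γ ⇒ Δ ▸ ¬ χ ▸ α)
¬-from-assumption d = provable-mono ⊆-refl
  (λ { (here refl) → there (here refl) ; (there (here refl)) → here refl
     ; (there (there i)) → there (there i) })
  (derive ⇒¬ (λ ()) (d ∷ []))

-- The extra `χ` gives invertibility when `χ` is a binary compound of `α` and `β`: if `χ` holds
-- while one of the four formulas fails, then `χ` is not ½, hence is 𝟏, and `¬ χ` fails.
gluts : Formula → Formula → Formula → Sequent → List Sequent
gluts χ α β (Γ ⇒ Δ) = (Γ ▸ χ ⇒ Δ ▸ α) ∷ (Γ ▸ χ ⇒ Δ ▸ ¬ α) ∷
                      (Γ ▸ χ ⇒ Δ ▸ β) ∷ (Γ ▸ χ ⇒ Δ ▸ ¬ β) ∷ []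

-- `⇒¬` turns the assumption `χ` into a side formula `¬ χ`, and `rule` adds a second copy, which
-- merges with the first.
derive-glut : ∀ {χ} →
  (∀ {Δ} → All Provable ((Γ ⇒ Δ ▸ α) ∷ (Γ ⇒ Δ ▸ ¬ α) ∷ (Γ ⇒ Δ ▸ β) ∷ (Γ ⇒ Δ ▸ ¬ β) ∷ []) →
           Provable (Γ ⇒ Δ ▸ ¬ χ)) →
  All Provable (gluts χ α β (Γ ⇒ Δ)) → Provable (Γ ⇒ Δ ▸ ¬ χ)
derive-glut rule (d₁ ∷ d₂ ∷ d₃ ∷ d₄ ∷ []) =
  provable-mono ⊆-refl (λ { (here refl) → here refl ; (there i) → i })
    (rule (¬-from-assumption d₁ ∷ ¬-from-assumption d₂ ∷
           ¬-from-assumption d₃ ∷ ¬-from-assumption d₄ ∷ []))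

-- Reduction of formulas to literals

reduce-literal-left : ∀ ℓ → Reducible (Γ ⇒ Δ) → Reducible (Γ ▸ formula ℓ ⇒ Δ)
reduce-literal-left {Γ = Γ} ℓ g L R =
  decided-resp-≈ (bag-=⇒ (↭⇒∼bag (shift _ Γ _)) , SetEq.refl) (g (ℓ ∷ L) R)

reduce-literal-right : ∀ ℓ → Reducible (Γ ⇒ Δ) → Reducible (Γ ⇒ Δ ▸ formula ℓ)
reduce-literal-right {Δ = Δ} ℓ g L R =
  decided-resp-≈ (SetEq.refl , bag-=⇒ (↭⇒∼bag (shift _ Δ _))) (g L (ℓ ∷ R))

-- Treating `¬ α` by separate functions of `α` makes the recursion structural, although premises may
-- contain negated components.
left   : ∀ α → Reducible (Γ ⇒ Δ) → Reducible (Γ ▸ α ⇒ Δ)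
right  : ∀ α → Reducible (Γ ⇒ Δ) → Reducible (Γ ⇒ Δ ▸ α)
left¬  : ∀ α → Reducible (Γ ⇒ Δ) → Reducible (Γ ▸ ¬ α ⇒ Δ)
right¬ : ∀ α → Reducible (Γ ⇒ Δ) → Reducible (Γ ⇒ Δ ▸ ¬ α)

left (var n) g = reduce-literal-left (true , n) g
left (α ∧ β) g = reduce-by (∧⇒ {[]} {p} {q} {[]}) α β (λ _ → derive ∧⇒ λ ())
  (left β (left α g) ∷ [])
left (α ∨ β) g = reduce-by (∨⇒ {[]} {p} {[]} {q}) α β (λ _ → derive ∨⇒ λ ())
  (left α g ∷ left β g ∷ [])
left (α ⟶ β) g = reduce-by (⟶⇒ {[]} {[]} {p} {q}) α β (λ _ → derive ⟶⇒ λ ())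
  (right α g ∷ left β g ∷ [])
left (¬ α)   g = left¬ α g
left (∘ α)   g = reduce-by (∘⇒ {[]} {[]} {p}) α α (λ _ → derive ∘⇒ λ ())
  (right α g ∷ right¬ α g ∷ [])

right (var n) g = reduce-literal-right (true , n) g
right (α ∧ β) g = reduce-by (⇒∧ {[]} {[]} {p} {q}) α β (λ _ → derive ⇒∧ λ ())
  (right α g ∷ right β g ∷ [])
right (α ∨ β) g = reduce-by (⇒∨ {[]} {[]} {p} {q}) α β (λ _ → derive ⇒∨ λ ())
  (right β (right α g) ∷ [])
right (α ⟶ β) g = reduce-by (⇒⟶ {[]} {p} {[]} {q}) α β (λ _ → derive ⇒⟶ λ ())
  (right β (left α g) ∷ [])
right (¬ α)   g = right¬ α g
right (∘ α)   g = reduce-by (⇒∘ {[]} {p} {[]}) α α (λ _ → derive ⇒∘ λ ())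
  (left¬ α (left α g) ∷ [])

left¬ (var n) g = reduce-literal-left (false , n) g
left¬ (α ∧ β) g = reduce-by (¬∧⇒ {[]} {[]} {p} {q}) α β (λ _ → derive ¬∧⇒ λ ())
  (right β (right α g) ∷ right α (left¬ α g) ∷ right β (left¬ β g) ∷ left¬ β (left¬ α g) ∷ [])
left¬ (α ∨ β) g = reduce-by (¬∨⇒ {[]} {p} {q} {[]}) α β (λ _ → derive ¬∨⇒ λ ())
  (left¬ β (left β (left¬ α (left α g))) ∷ right β (right α (left¬ β (left¬ α g))) ∷ [])
left¬ (α ⟶ β) g = reduce-by (¬⟶⇒ {[]} {p} {q} {[]}) α β (λ _ → derive ¬⟶⇒ λ ())
  (right β (left¬ β (left α g)) ∷ left¬ β (left¬ α (left α g)) ∷ [])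
left¬ (¬ α)   g = reduce-by (¬¬⇒ {[]} {p} {[]}) α α (λ _ → derive ¬¬⇒ λ ())
  (left α g ∷ [])
left¬ (∘ α)   g = reduce-by (¬∘⇒ {[]} {p} {[]}) α α (λ _ → derive ¬∘⇒ λ ())
  (left¬ α (left α g) ∷ [])

right¬ (var n) g = reduce-literal-right (false , n) g
-- This call keeps the same formula, but `left` then descends to its components, so the recursion
-- terminates.
right¬ (α ∧ β) g = let h = left (α ∧ β) g in
  reduce (gluts (p ∧ q) p q ([] ⇒ [])) ([] ⇒ [] ▸ ¬ (p ∧ q)) α β
    (λ _ → derive-glut (derive ⇒¬∧ λ ()))
    (right α h ∷ right¬ α h ∷ right β h ∷ right¬ β h ∷ [])
right¬ (α ∨ β) g = let h = left (α ∨ β) g in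
  reduce (gluts (p ∨ q) p q ([] ⇒ [])) ([] ⇒ [] ▸ ¬ (p ∨ q)) α β
    (λ _ → derive-glut (derive ⇒¬∨ λ ()))
    (right α h ∷ right¬ α h ∷ right β h ∷ right¬ β h ∷ [])
right¬ (α ⟶ β) g = let h = left (α ⟶ β) g in
  reduce (gluts (p ⟶ q) p q ([] ⇒ [])) ([] ⇒ [] ▸ ¬ (p ⟶ q)) α β
    (λ _ → derive-glut (derive ⇒¬⟶ λ ()))
    (right α h ∷ right¬ α h ∷ right β h ∷ right¬ β h ∷ [])
right¬ (¬ α)   g = reduce-by (⇒¬¬ {[]} {[]} {p}) α α (λ _ → derive ⇒¬¬ λ ())
  (right α g ∷ [])
-- Here `⇒¬` is invertible, since `∘ α` never takes the value ½.
right¬ (∘ α)   g = reduce ((([] ▸ ∘ p) ⇒ []) ∷ []) ([] ⇒ [] ▸ ¬ ∘ p) α α (λ _ → derive ⇒¬ λ ())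
  (left (∘ α) g ∷ [])

reducible : ∀ Γ Δ → Reducible (Γ ⇒ Δ)
reducible []      []      = decide-literals
reducible []      (α ∷ Δ) = right α (reducible [] Δ)
reducible (α ∷ Γ) Δ       = left α (reducible Γ Δ)

decide : ∀ S → Decided S
decide S@(Γ ⇒ Δ) = subst Decided (⊕-identityʳ S) (reducible Γ Δ [] [])

corollary4p9 : (Γ Δ : FinSet) → Proof (Γ ⇒ Δ) → Σ[ d ∈ Proof (Γ ⇒ Δ) ] CutFree d
corollary4p9 Γ Δ d with decide (Γ ⇒ Δ)
... | inj₁ d′      = d′
... | inj₂ (v , c) = ⊥-elim (irrefutable d c)
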